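{- Let $k \ge 1$ and $m \ge 1$, and define \[ a(n) = \begin{cases} \frac14\binom{n+2}{3}, & n \text{ even},\\ \frac{1}{24}(n-1)(n+1)(n+3), & n \text{ odd}\end{cases} \] (the number of odd biGrassmannian permutations of $[n]$). Then the number of odd biGrassmannian permutations of $[m]$ that avoid $\operatorname{id}_k=12\cdots k$ equals $a(m)$ if $m \le k$; equals $a(2k-m)$ if $k < m < 2k$ and $m-k$ is even; equals $a(2k-m-2)$ if $k < m < 2k$ and $m-k$ is odd; and equals $0$ if $m \ge 2k$.
   Context: A permutation is Grassmannian if it has at most one descent; it is biGrassmannian if both it and its inverse are Grassmannian; it is odd if it has an odd number of inversions. A permutation avoids $12\cdots k$ if it has no increasing subsequence of length $k$. -}

module Defs where

open import Data.Fin.Base using (Fin; toℕ; _<_)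
open import Data.Fin.Permutation using (Permutation′; _⟨$⟩ʳ_; flip; _≈_)
open import Data.Fin.Properties using (_<?_)
open import Data.Integer.Base as ℤ using (ℤ; +_; -[1+_]; -1ℤ; ∣_∣)
open import Data.List.Base using (List; length; filter; allFin; cartesianProduct)
open import Data.Nat.Base as ℕ using (ℕ; suc; parity)
open import Data.Nat.Combinatorics using (_C_)
open import Data.Parity.Base using (0ℙ; 1ℙ)
open import Data.Product.Base using (Σ; ∃-syntax; _×_; _,_; proj₁)
open import Data.Rational.Base using (ℚ; _/_)
open import Function.Bundles using (Inverse)
open import Level using (0ℓ)
open import Relation.Binary.Bundles using (Setoid)
import Relation.Binary.Construct.On as On
open import Relation.Binary.PropositionalEquality using (_≡_; refl; sym; trans; setoid)
open import Relation.Nullary.Decidable using (_×-dec_)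
open import Relation.Nullary.Negation using (¬_)
open import Relation.Unary using (Decidable)

Even Odd : ℕ → Set
Even n = parity n ≡ 0ℙ
Odd  n = parity n ≡ 1ℙ

-- Permutations of [n] are permutations of Fin n, i.e. of {0, …, n-1}.

IsDescent : ∀ {n} → Permutation′ n → Fin n → Set
IsDescent π i = ∃[ j ] toℕ j ≡ suc (toℕ i) × (π ⟨$⟩ʳ j) < (π ⟨$⟩ʳ i)

Grassmannian : ∀ {n} → Permutation′ n → Set
Grassmannian π = ∀ i j → IsDescent π i → IsDescent π j → i ≡ j

BiGrassmannian : ∀ {n} → Permutation′ n → Set
BiGrassmannian π = Grassmannian π × Grassmannian (flip π)

IsInversion : ∀ {n} → Permutation′ n → Fin n × Fin n → Set
IsInversion π (i , j) = i < j × (π ⟨$⟩ʳ j) < (π ⟨$⟩ʳ i)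

isInversion? : ∀ {n} (π : Permutation′ n) → Decidable (IsInversion π)
isInversion? π (i , j) = (i <? j) ×-dec ((π ⟨$⟩ʳ j) <? (π ⟨$⟩ʳ i))

inversions : ∀ {n} → Permutation′ n → List (Fin n × Fin n)
inversions {n} π = filter (isInversion? π) (cartesianProduct (allFin n) (allFin n))

OddPermutation : ∀ {n} → Permutation′ n → Set
OddPermutation π = Odd (length (inversions π))

StrictlyIncreasing : ∀ {k n} → (Fin k → Fin n) → Set
StrictlyIncreasing f = ∀ {i j} → i < j → f i < f j

-- An increasing subsequence of length k is given by its positions f.
AvoidsId : ∀ {n} → ℕ → Permutation′ n → Set
AvoidsId {n} k π =
  ¬ (Σ (Fin k → Fin n) λ f → StrictlyIncreasing f × StrictlyIncreasing (λ i → π ⟨$⟩ʳ f i))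

permutationSetoid : ℕ → Setoid 0ℓ 0ℓ
permutationSetoid n = record
  { Carrier       = Permutation′ n
  ; _≈_           = _≈_
  ; isEquivalence = record
    { refl  = λ _ → refl
    ; sym   = λ p i → sym (p i)
    ; trans = λ p q i → trans (p i) (q i)
    }
  }

-- The permutations satisfying P, identified when they agree as functions
-- (in particular regardless of the proof of P).
PermutationsWith : ∀ {n} → (Permutation′ n → Set) → Setoid 0ℓ 0ℓ
PermutationsWith {n} P = On.setoid {B = Σ (Permutation′ n) P} (permutationSetoid n) proj₁

HasCardinality : Setoid 0ℓ 0ℓ → ℕ → Set
HasCardinality S N = Inverse S (setoid (Fin N))

-- Rational-valued because the closed formula it is compared with is a quotient.
NumberOfPermutations[_∣_]≡_ : (n : ℕ) → (Permutation′ n → Set) → ℚ → Set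
NumberOfPermutations[ n ∣ P ]≡ q =
  ∃[ N ] HasCardinality (PermutationsWith {n} P) N × (+ N) / 1 ≡ q

-- x(x-1)⋯(x-k+1)/k!, using upper negation for negative x.
binomial : ℤ → ℕ → ℤ
binomial (+ n)    k = + (n C k)
binomial -[1+ n ] k = (-1ℤ ℤ.^ k) ℤ.* + ((n ℕ.+ k) C k)

-- The domain is ℤ because 2k-m-2 is -1 when m = 2k-1 and m-k is odd; the
-- formula for odd n then gives 0.
a : ℤ → ℚ
a n with parity ∣ n ∣
... | 0ℙ = binomial (n ℤ.+ + 2) 3 / 4
... | 1ℙ = ((n ℤ.- + 1) ℤ.* (n ℤ.+ + 1) ℤ.* (n ℤ.+ + 3)) / 24

OddBiGrassmannianAvoiding : ∀ {n} → ℕ → Permutation′ n → Set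
OddBiGrassmannianAvoiding k π = OddPermutation π × BiGrassmannian π × AvoidsId k π

{-# OPTIONS --safe #-}

-- A biGrassmannian permutation other than the identity exchanges two adjacent blocks of
-- sizes b, c ≥ 1 and fixes the x points before and the y points after them.  It has b c
-- inversions, and its longest increasing subsequences skip one of the two blocks, so they
-- have length m - min b c.  Hence the permutations to be counted are the solutions of
-- x + b + c + y = m with b and c odd and greater than m - k.  If e is the least even
-- number with e ≥ max 0 (m - k), then b = 2 i + e + 1 and c = 2 j + e + 1, and what is left is
-- the number of solutions of x + y + 2 i + 2 j = m - 2 e - 2, which is a (m - 2 e).

module Submission where

open import Defs
open import Data.Bool.Base using (if_then_else_)
open import Data.Fin.Base as Fin using (Fin; toℕ; fromℕ<; inject)
open import Data.Fin.Permutation using (Permutation′; _⟨$⟩ʳ_; flip; inverseˡ; inverseʳ)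
open import Data.Fin.Properties as Fin using (toℕ<n; toℕ-fromℕ<; fromℕ<-toℕ; toℕ-injective; toℕ-inject; +↔⊎)
import Data.Integer.Properties as ℤ
open import Data.List.Base using ([]; _∷_; _++_; length; map; filter; allFin; cartesianProduct)
open import Data.List.Properties using (filter-≐; filter-none; filter-++; filter-accept; filter-reject; length-++; map-tabulate)
open import Data.List.Relation.Unary.All using (universal)
open import Data.Nat.Base using (ℕ; zero; suc; _+_; _*_; _∸_; _≤_; _<_; z≤n; s≤s; z<s; s<s⁻¹; parity)
open import Data.Nat.Combinatorics using (_C_; nC1≡n; nCk+nC[k+1]≡[n+1]C[k+1])
open import Data.Nat.Properties
open import Algebra.Properties.CommutativeSemigroup +-commutativeSemigroup using (xy∙z≈xz∙y)
open import Data.Nat.Tactic.RingSolver using (solve-∀)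
open import Data.Parity.Base as ℙ using (0ℙ; 1ℙ)
open import Data.Parity.Properties using (suc-homo-⁻¹; +-homo-+; *-homo-*)
open import Data.Product.Base using (Σ; ∃-syntax; _×_; _,_; proj₁; proj₂)
open import Data.Rational.Base using (ℚ; 0ℚ; _/_)
open import Data.Rational.Properties using (fromℚᵘ-cong)
open import Data.Rational.Unnormalised.Base using (mkℚᵘ; *≡*)
open import Data.Sum.Base using (_⊎_; inj₁; inj₂)
open import Data.Sum.Function.Propositional using (_⊎-↔_)
open import Function.Base using (_∘_)
open import Function.Bundles using (mk↔ₛ′; _↔_; Inverse)
open import Function.Construct.Composition using (_↔-∘_) renaming (inverse to _∘-inverse_)
open import Function.Construct.Identity using (↔-id)
open import Function.Construct.Symmetry using (↔-sym)
open import Level using (0ℓ)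
open import Relation.Binary.Bundles using (Setoid)
open import Relation.Binary.Definitions using (tri<; tri≈; tri>)
open import Relation.Binary.PropositionalEquality
open import Relation.Nullary using (¬_; does; yes; no; contradiction)
open import Relation.Nullary.Decidable using (_×-dec_; dec-true; dec-false)
open import Relation.Unary using (Decidable)

-- Block swaps on ℕ

-- Permutations of `Fin m` are extended by the identity to bijections of ℕ. Successors and shifted
-- positions then always exist, and the classification needs no case for a right border. No descent
-- arises at the border, since the value `m` at position `m` exceeds all values before it. Passing
-- to the inverse exchanges `b` and `c`, so most facts are proved for one block or one direction and
-- used for both. Rounding `m - k` up to an even `e` loses nothing, because an odd size never equals
-- an even number, and it makes `b - e - 1` even. The choices `e = 0`, `m - k` and `m - k + 1` turn
-- `m - 2 e` into `m`, `2 k - m` and `2 k - m - 2`, so a single count serves every case. If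
-- `m ≥ 2 k`, there are fewer than `2 e + 2` points, too few for two blocks.

blockSwap : ℕ → ℕ → ℕ → ℕ → ℕ
blockSwap x b c i =
  if does (i <? x) then i else
  if does (i <? x + b) then i + c else
  if does (i <? x + b + c) then i ∸ b else i

-- Each position carries its offset in its region, so that values of `blockSwap` can be stated as
-- sums, without truncated subtraction.
data Region (x b c : ℕ) : ℕ → Set where
  below : ∀ {i} → i < x → Region x b c i
  left  : ∀ {j} → j < b → Region x b c (x + j)
  right : ∀ {j} → j < c → Region x b c (x + b + j)
  above : ∀ j → Region x b c (x + b + c + j)

region : ∀ x b c i → Region x b c i
region x b c i with i <? x
... | yes i<x = below i<x
... | no  i≮x with m≤n⇒∃[o]m+o≡n (≮⇒≥ i≮x)
... | j , refl with j <? b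
... | yes j<b = left j<b
... | no  j≮b with m≤n⇒∃[o]m+o≡n (≮⇒≥ j≮b)
... | j′ , refl rewrite sym (+-assoc x b j′) with j′ <? c
... | yes j<c = right j<c
... | no  j≮c with m≤n⇒∃[o]m+o≡n (≮⇒≥ j≮c)
... | j″ , refl rewrite sym (+-assoc (x + b) c j″) = above j″

module _ (x b c : ℕ) where

  blockSwap-below : ∀ {i} → i < x → blockSwap x b c i ≡ i
  blockSwap-below {i} i<x rewrite dec-true (i <? x) i<x = refl

  blockSwap-left : ∀ {j} → j < b → blockSwap x b c (x + j) ≡ x + c + j
  blockSwap-left {j} j<b
    rewrite dec-false (x + j <? x) (m+n≮m x j)
          | dec-true (x + j <? x + b) (+-monoʳ-< x j<b) = lemma x j c
    where
    lemma : ∀ x j c → x + j + c ≡ x + c + j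
    lemma = solve-∀

  blockSwap-right : ∀ {j} → j < c → blockSwap x b c (x + b + j) ≡ x + j
  blockSwap-right {j} j<c
    rewrite dec-false (x + b + j <? x) (≤⇒≯ (≤-trans (m≤m+n x b) (m≤m+n (x + b) j)))
          | dec-false (x + b + j <? x + b) (m+n≮m (x + b) j)
          | dec-true (x + b + j <? x + b + c) (+-monoʳ-< (x + b) j<c)
          = trans (cong (_∸ b) (lemma x b j)) (m+n∸n≡m (x + j) b)
    where
    lemma : ∀ x b j → x + b + j ≡ x + j + b
    lemma = solve-∀

  blockSwap-above : ∀ {i} → x + b + c ≤ i → blockSwap x b c i ≡ i
  blockSwap-above {i} v≤i
    rewrite dec-false (i <? x) (≤⇒≯ (≤-trans (≤-trans (m≤m+n x b) (m≤m+n (x + b) c)) v≤i))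
          | dec-false (i <? x + b) (≤⇒≯ (≤-trans (m≤m+n (x + b) c) v≤i))
          | dec-false (i <? x + b + c) (≤⇒≯ v≤i) = refl

blockSwap-inverse : ∀ x b c i → blockSwap x c b (blockSwap x b c i) ≡ i
blockSwap-inverse x b c i with region x b c i
... | below i<x rewrite blockSwap-below x b c i<x = blockSwap-below x c b i<x
... | left  j<b rewrite blockSwap-left  x b c j<b = blockSwap-right x c b j<b
... | right j<c rewrite blockSwap-right x b c j<c = blockSwap-left  x c b j<c
... | above j   rewrite blockSwap-above x b c (m≤m+n (x + b + c) j) =
  blockSwap-above x c b (subst (_≤ x + b + c + j) (xy∙z≈xz∙y x b c) (m≤m+n (x + b + c) j))

blockSwap-< : ∀ x b c {m i} → x + b + c ≤ m → i < m → blockSwap x b c i < m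
blockSwap-< x b c {m} {i} v≤m i<m with region x b c i
... | below i<x rewrite blockSwap-below x b c i<x = i<m
... | left  j<b rewrite blockSwap-left  x b c j<b =
  <-≤-trans (+-monoʳ-< (x + c) j<b) (subst (_≤ m) (xy∙z≈xz∙y x b c) v≤m)
... | right {j} j<c rewrite blockSwap-right x b c j<c =
  ≤-<-trans (+-monoˡ-≤ j (m≤m+n x b)) i<m
... | above j   rewrite blockSwap-above x b c (m≤m+n (x + b + c) j) = i<m

blockSwap-≥ : ∀ x b c {i} → x ≤ i → x ≤ blockSwap x b c i
blockSwap-≥ x b c {i} x≤i with region x b c i
... | below i<x     = contradiction x≤i (<⇒≱ i<x)
... | left  {j} j<b rewrite blockSwap-left  x b c j<b = ≤-trans (m≤m+n x c) (m≤m+n (x + c) j)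
... | right {j} j<c rewrite blockSwap-right x b c j<c = m≤m+n x j
... | above j       rewrite blockSwap-above x b c (m≤m+n (x + b + c) j) = x≤i

-- Each block is translated and all other points stay, so order is reversed only between the two
-- blocks. This locates any descent and, with the converse `blockSwap-inverts`, makes the inversion
-- set a product of two intervals.
blockSwap-inversion : ∀ x b c {i j} → i < j → blockSwap x b c j < blockSwap x b c i →
  (x ≤ i × i < x + b) × (x + b ≤ j × j < x + b + c)
blockSwap-inversion x b c {i} {j} i<j inv with region x b c j
... | above q rewrite blockSwap-above x b c (m≤m+n (x + b + c) q) =
  contradiction inv (<-asym (blockSwap-< x b c (m≤m+n (x + b + c) q) i<j))
... | below j<x rewrite blockSwap-below x b c j<x | blockSwap-below x b c (<-trans i<j j<x) =
  contradiction inv (<-asym i<j)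
... | left {q} q<b with region x b c i
...   | below i<x rewrite blockSwap-below x b c i<x =
  contradiction (blockSwap-≥ x b c (m≤m+n x q)) (<⇒≱ (<-trans inv i<x))
...   | left {p} p<b rewrite blockSwap-left x b c p<b | blockSwap-left x b c q<b =
  contradiction (+-monoʳ-< (x + c) (+-cancelˡ-< x p q i<j)) (<-asym inv)
...   | right {p} p<c = contradiction (<-trans i<j (+-monoʳ-< x q<b)) (m+n≮m (x + b) p)
...   | above p =
  contradiction (<-trans i<j (+-monoʳ-< x q<b))
    (≤⇒≯ (≤-trans (m≤m+n (x + b) c) (m≤m+n (x + b + c) p)))
blockSwap-inversion x b c {i} i<j inv | right {q} q<c with region x b c i
...   | below i<x rewrite blockSwap-below x b c i<x =
  contradiction (blockSwap-≥ x b c (≤-trans (m≤m+n x b) (m≤m+n (x + b) q))) (<⇒≱ (<-trans inv i<x))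
...   | left {p} p<b =
  (m≤m+n x p , +-monoʳ-< x p<b) , (m≤m+n (x + b) q , +-monoʳ-< (x + b) q<c)
...   | right {p} p<c rewrite blockSwap-right x b c p<c | blockSwap-right x b c q<c =
  contradiction (+-monoʳ-< x (+-cancelˡ-< (x + b) p q i<j)) (<-asym inv)
...   | above p =
  contradiction (<-trans i<j (+-monoʳ-< (x + b) q<c)) (m+n≮m (x + b + c) p)

blockSwap-inverts : ∀ x b c {i j} → x ≤ i → i < x + b → x + b ≤ j → j < x + b + c →
  blockSwap x b c j < blockSwap x b c i
blockSwap-inverts x b c x≤i i<x+b x+b≤j j<v
  with m≤n⇒∃[o]m+o≡n x≤i | m≤n⇒∃[o]m+o≡n x+b≤j
... | p , refl | q , refl
  rewrite blockSwap-left x b c (+-cancelˡ-< x p b i<x+b)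
        | blockSwap-right x b c (+-cancelˡ-< (x + b) q c j<v) =
  <-≤-trans (+-monoʳ-< x (+-cancelˡ-< (x + b) q c j<v)) (m≤m+n (x + c) p)

-- The increasing enumeration of the numbers outside the `l` points from `s` on.
skip : ℕ → ℕ → ℕ → ℕ
skip s l i = if does (i <? s) then i else i + l

skip-below : ∀ s l {i} → i < s → skip s l i ≡ i
skip-below s l {i} i<s rewrite dec-true (i <? s) i<s = refl

skip-above : ∀ s l {i} → s ≤ i → skip s l i ≡ i + l
skip-above s l {i} s≤i rewrite dec-false (i <? s) (≤⇒≯ s≤i) = refl

skip-mono-< : ∀ s l {i j} → i < j → skip s l i < skip s l j
skip-mono-< s l {i} {j} i<j with i <? s | j <? s
... | yes i<s | yes j<s rewrite skip-below s l i<s | skip-below s l j<s = i<j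
... | yes i<s | no  j≮s rewrite skip-below s l i<s | skip-above s l (≮⇒≥ j≮s) =
  <-≤-trans i<j (m≤m+n j l)
... | no  i≮s | yes j<s = contradiction (<-trans i<j j<s) i≮s
... | no  i≮s | no  j≮s rewrite skip-above s l (≮⇒≥ i≮s) | skip-above s l (≮⇒≥ j≮s) =
  +-monoˡ-< l i<j

skip-< : ∀ s l {i n} → i < n → skip s l i < n + l
skip-< s l {i} {n} i<n with i <? s
... | yes i<s rewrite skip-below s l i<s = <-≤-trans i<n (m≤m+n n l)
... | no  i≮s rewrite skip-above s l (≮⇒≥ i≮s) = +-monoˡ-< l i<n

-- Without the right block, the left block is pushed up by `c` and the values miss exactly the `c`
-- points from `x` on. Both sides increase with `i`, which exhibits a long increasing subsequence.
blockSwap-skip-right : ∀ x b c i → blockSwap x b c (skip (x + b) c i) ≡ skip x c i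
blockSwap-skip-right x b c i with i <? x
... | yes i<x rewrite skip-below (x + b) c (<-≤-trans i<x (m≤m+n x b)) | skip-below x c i<x =
  blockSwap-below x b c i<x
... | no  i≮x rewrite skip-above x c (≮⇒≥ i≮x) with i <? x + b
...   | no  i≮x+b rewrite skip-above (x + b) c (≮⇒≥ i≮x+b) =
  blockSwap-above x b c (+-monoˡ-≤ c (≮⇒≥ i≮x+b))
...   | yes i<x+b rewrite skip-below (x + b) c i<x+b with m≤n⇒∃[o]m+o≡n (≮⇒≥ i≮x)
...     | j , refl = trans (blockSwap-left x b c (+-cancelˡ-< x j b i<x+b)) (xy∙z≈xz∙y x c j)

blockSwap-skip-left : ∀ x b c i → blockSwap x b c (skip x b i) ≡ skip (x + c) b i
blockSwap-skip-left x b c i = begin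
  blockSwap x b c (skip x b i)                               ≡⟨ cong (blockSwap x b c) (blockSwap-skip-right x c b i) ⟨
  blockSwap x b c (blockSwap x c b (skip (x + c) b i))       ≡⟨ blockSwap-inverse x c b _ ⟩
  skip (x + c) b i                                           ∎
  where open ≡-Reasoning

-- The inverse of `skip`, meaningful only off the gap that it closes; hence `OutsideGap` in the
-- lemmas below.
squash : ℕ → ℕ → ℕ → ℕ
squash s l i = if does (i <? s) then i else i ∸ l

squash-below : ∀ s l {i} → i < s → squash s l i ≡ i
squash-below s l {i} i<s rewrite dec-true (i <? s) i<s = refl

squash-above : ∀ s l {i} → s + l ≤ i → squash s l i ≡ i ∸ l
squash-above s l {i} s+l≤i rewrite dec-false (i <? s) (≤⇒≯ (≤-trans (m≤m+n s l) s+l≤i)) = refl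

OutsideGap : ℕ → ℕ → ℕ → Set
OutsideGap s l i = i < s ⊎ s + l ≤ i

squash-mono-< : ∀ s l {i j} → OutsideGap s l i → OutsideGap s l j → i < j →
  squash s l i < squash s l j
squash-mono-< s l (inj₁ i<s) (inj₁ j<s) i<j
  rewrite squash-below s l i<s | squash-below s l j<s = i<j
squash-mono-< s l (inj₁ i<s) (inj₂ s+l≤j) i<j
  rewrite squash-below s l i<s | squash-above s l s+l≤j = <-≤-trans i<s (m+n≤o⇒m≤o∸n s s+l≤j)
squash-mono-< s l (inj₂ s+l≤i) (inj₁ j<s) i<j =
  contradiction (<-trans i<j j<s) (≤⇒≯ (≤-trans (m≤m+n s l) s+l≤i))
squash-mono-< s l (inj₂ s+l≤i) (inj₂ s+l≤j) i<j
  rewrite squash-above s l s+l≤i | squash-above s l s+l≤j =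
  ∸-monoˡ-< i<j (≤-trans (m≤n+m l s) s+l≤i)

squash-< : ∀ s l r {i} → OutsideGap s l i → i < s + r + l → squash s l i < s + r
squash-< s l r (inj₁ i<s) i<n rewrite squash-below s l i<s = <-≤-trans i<s (m≤m+n s r)
squash-< s l r {i} (inj₂ s+l≤i) i<n rewrite squash-above s l s+l≤i =
  subst (i ∸ l <_) (m+n∸n≡m (s + r) l) (∸-monoˡ-< i<n (≤-trans (m≤n+m l s) s+l≤i))

blockSwap-start : ∀ x b c → blockSwap x (suc b) c x ≡ x + c
blockSwap-start x b c = begin
  blockSwap x (suc b) c x       ≡⟨ cong (blockSwap x (suc b) c) (+-identityʳ x) ⟨
  blockSwap x (suc b) c (x + 0) ≡⟨ blockSwap-left x (suc b) c z<s ⟩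
  x + c + 0                     ≡⟨ +-identityʳ _ ⟩
  x + c                         ∎
  where open ≡-Reasoning

-- For nonempty blocks, `x` is the least moved point and its value `x + suc c` reveals `c`. The
-- inverse has the blocks exchanged and reveals `b` in the same way.
blockSwap-injective : ∀ x b c x′ b′ c′ →
  (∀ i → blockSwap x (suc b) (suc c) i ≡ blockSwap x′ (suc b′) (suc c′) i) →
  x ≡ x′ × b ≡ b′ × c ≡ c′
blockSwap-injective x b c x′ b′ c′ eq with support x b c x′ b′ c′ eq | support x′ b′ c′ x b c (sym ∘ eq)
  where
  support : ∀ x b c x′ b′ c′ →
    (∀ i → blockSwap x (suc b) (suc c) i ≡ blockSwap x′ (suc b′) (suc c′) i) → x′ ≤ x
  support x b c x′ b′ c′ eq = ≮⇒≥ λ x<x′ → m≢1+m+n x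
    (trans (sym (blockSwap-below x′ (suc b′) (suc c′) x<x′))
      (trans (sym (eq x)) (trans (blockSwap-start x b (suc c)) (+-suc x c))))
... | x′≤x | x≤x′ with ≤-antisym x≤x′ x′≤x
... | refl = refl , shift x c b c′ b′ eq⁻¹ , shift x b c b′ c′ eq
  where
  shift : ∀ x b c b′ c′ →
    (∀ i → blockSwap x (suc b) (suc c) i ≡ blockSwap x (suc b′) (suc c′) i) → c ≡ c′
  shift x b c b′ c′ eq =
    suc-injective (+-cancelˡ-≡ x _ _ (trans (sym (blockSwap-start x b (suc c))) (trans (eq x) (blockSwap-start x b′ (suc c′)))))
  eq⁻¹ : ∀ i → blockSwap x (suc c) (suc b) i ≡ blockSwap x (suc c′) (suc b′) i
  eq⁻¹ i = begin
    blockSwap x (suc c) (suc b) i ≡⟨ cong (blockSwap x (suc c) (suc b)) (blockSwap-inverse x (suc c′) (suc b′) i) ⟨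
    blockSwap x (suc c) (suc b) (blockSwap x (suc b′) (suc c′) (blockSwap x (suc c′) (suc b′) i))
      ≡⟨ cong (blockSwap x (suc c) (suc b)) (eq _) ⟨
    blockSwap x (suc c) (suc b) (blockSwap x (suc b) (suc c) (blockSwap x (suc c′) (suc b′) i))
      ≡⟨ blockSwap-inverse x (suc b) (suc c) _ ⟩
    blockSwap x (suc c′) (suc b′) i ∎
    where open ≡-Reasoning

-- Bijections of ℕ with at most one descent in each direction

AtMostOneDescent : (ℕ → ℕ) → Set
AtMostOneDescent f = ∀ {i j} → f (suc i) < f i → f (suc j) < f j → i ≡ j

module _ {f g : ℕ → ℕ} (gf : ∀ i → g (f i) ≡ i) where

  inverse⇒injective : ∀ {i j} → f i ≡ f j → i ≡ j
  inverse⇒injective {i} {j} eq = trans (sym (gf i)) (trans (cong g eq) (gf j))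

  fixedBelow⇒≥ : ∀ {x} → (∀ {i} → i < x → f i ≡ i) → ∀ {i} → x ≤ i → x ≤ f i
  fixedBelow⇒≥ fix {i} x≤i = ≮⇒≥ λ fi<x →
    contradiction (subst (_< _) (inverse⇒injective (fix fi<x)) fi<x) (≤⇒≯ x≤i)

  fixedBelow-inverse : ∀ {x} → (∀ {i} → i < x → f i ≡ i) → ∀ {i} → i < x → g i ≡ i
  fixedBelow-inverse fix {i} i<x = trans (cong g (sym (fix i<x))) (gf i)

  ascent : AtMostOneDescent f → ∀ {d} → f (suc d) < f d → ∀ {j} → j ≢ d → f j < f (suc j)
  ascent gr {d} desc {j} j≢d with <-cmp (f j) (f (suc j))
  ... | tri< lt _ _ = lt
  ... | tri≈ _ eq _ = contradiction (sym (inverse⇒injective eq)) 1+n≢n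
  ... | tri> _ _ gt = contradiction (gr gt desc) j≢d

increasing⇒monotone : ∀ {g : ℕ → ℕ} t → (∀ j → g (t + j) < g (suc (t + j))) → ∀ r → g t ≤ g (t + r)
increasing⇒monotone {g} t inc zero    = ≤-reflexive (cong g (sym (+-identityʳ t)))
increasing⇒monotone {g} t inc (suc r) =
  ≤-trans (increasing⇒monotone {g} t inc r) (<⇒≤ (subst (λ u → g (t + r) < g u) (sym (+-suc t r)) (inc r)))

-- A value strictly between f (s + j) and f (s + j + 1) would be taken by g strictly between
-- s + j and s + j + 1, so f advances by steps of 1.
run : ∀ {f g : ℕ → ℕ} → (∀ i → g (f i) ≡ i) → (∀ i → f (g i) ≡ i) → ∀ {s t} → f s ≡ t → ∀ l →
  (∀ {j} → suc j < l → f (s + j) < f (suc (s + j))) → (∀ j → g (t + j) < g (suc (t + j))) →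
  ∀ j → j < l → f (s + j) ≡ t + j
run {f} gf fg {s} {t} fs≡t l f-inc g-inc zero j<l =
  trans (cong f (+-identityʳ s)) (trans fs≡t (sym (+-identityʳ t)))
run {f} {g} gf fg {s} {t} fs≡t l f-inc g-inc (suc j) j<l
  rewrite +-suc s j | +-suc t j with run {f} {g} gf fg fs≡t l f-inc g-inc j (<-trans (n<1+n j) j<l)
... | ih with m≤n⇒∃[o]m+o≡n (subst (_< f (suc (s + j))) ih (f-inc j<l))
... | r , eq = trans (cong f (sym gv≡)) (fg v)
  where
  v = suc (t + j)
  gv≤ : g v ≤ suc (s + j)
  gv≤ = begin
    g v                  ≤⟨ increasing⇒monotone {g} v (λ i → subst (λ u → g u < g (suc u)) (shift t j i) (g-inc (suc j + i))) r ⟩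
    g (v + r)            ≡⟨ cong g eq ⟩
    g (f (suc (s + j)))  ≡⟨ gf _ ⟩
    suc (s + j)          ∎
    where
    open ≤-Reasoning
    shift : ∀ t j i → t + (suc j + i) ≡ suc (t + j) + i
    shift = solve-∀
  gv> : s + j < g v
  gv> = subst (_< g v) (trans (cong g (sym ih)) (gf _)) (g-inc j)
  gv≡ : g v ≡ suc (s + j)
  gv≡ = ≤-antisym gv≤ gv>

module _ {f g : ℕ → ℕ} (gf : ∀ i → g (f i) ≡ i) (fg : ∀ i → f (g i) ≡ i)
  {x : ℕ} (fix : ∀ {i} → i < x → f i ≡ i) where

  -- The value `x` is taken at `suc (x + b)`, while `f (x + b)` is at least `x` because the smaller
  -- values belong to fixed points, and differs from `x` by injectivity.
  descent-before : ∀ {b} → g x ≡ x + suc b → f (suc (x + b)) < f (x + b)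
  descent-before {b} gx≡ = subst (_< f (x + b)) (sym fs≡x)
    (≤∧≢⇒< (fixedBelow⇒≥ {f} {g} gf fix (m≤m+n x b))
      (λ x≡ → 1+n≢n (inverse⇒injective {f} {g} gf (trans fs≡x x≡))))
    where
    fs≡x : f (suc (x + b)) ≡ x
    fs≡x = trans (cong f (trans (sym (+-suc x b)) (sym gx≡))) (fg x)

  displaced : f x ≢ x → ∃[ c ] f x ≡ x + suc c
  displaced fx≢x with m≤n⇒∃[o]m+o≡n (≤∧≢⇒< (fixedBelow⇒≥ {f} {g} gf fix ≤-refl) (fx≢x ∘ sym))
  ... | c , eq = c , trans (sym eq) (sym (+-suc x c))

  -- The only descent of `f` is at `x + b`, the last point of the block, and that of `g` at `x + c`,
  -- just before `f x`. So `f` ascends within the block and `g` ascends from `f x` on, as `run`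
  -- requires.
  run-left : AtMostOneDescent f → AtMostOneDescent g → ∀ {b c} → g x ≡ x + suc b → f x ≡ x + suc c →
    g (suc (x + c)) < g (x + c) →
    ∀ {j} → j < suc b → f (x + j) ≡ x + suc c + j
  run-left f-gr g-gr {b} {c} gx≡ fx≡ g-desc {j} = run {f} {g} gf fg fx≡ (suc b)
    (λ {j} j<b → ascent {f} {g} gf f-gr (descent-before gx≡) (λ eq → <⇒≢ (s<s⁻¹ j<b) (+-cancelˡ-≡ x j b eq)))
    (λ j → ascent {g} {f} fg g-gr g-desc (λ eq → <⇒≢ (bound j) (sym eq)))
    j
    where
    bound : ∀ j → x + c < x + suc c + j
    bound j = <-≤-trans (+-monoʳ-< x (n<1+n c)) (m≤m+n _ j)

-- The descent of f is right before g x and that of g right before f x, so each block is a run.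
atMostOneDescent⇒blockSwap : ∀ {f g : ℕ → ℕ} → (∀ i → g (f i) ≡ i) → (∀ i → f (g i) ≡ i) →
  AtMostOneDescent f → AtMostOneDescent g →
  ∀ {x} → (∀ {i} → i < x → f i ≡ i) → f x ≢ x →
  ∃[ b ] ∃[ c ] ∀ i → f i ≡ blockSwap x (suc b) (suc c) i
atMostOneDescent⇒blockSwap {f} {g} gf fg f-gr g-gr {x} fix fx≢x
  with g-fix ← (λ {i} → fixedBelow-inverse {f} {g} gf fix {i})
  with displaced {f} {g} gf fg fix fx≢x
     | displaced {g} {f} fg gf g-fix (λ gx≡x → fx≢x (trans (cong f (sym gx≡x)) (fg x)))
... | c′ , fx≡ | b′ , gx≡ = b′ , c′ , f≗swap
  where
  b = suc b′
  c = suc c′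
  v = x + b + c

  f-desc : f (suc (x + b′)) < f (x + b′)
  f-desc = descent-before {f} {g} gf fg fix gx≡
  g-desc : g (suc (x + c′)) < g (x + c′)
  g-desc = descent-before {g} {f} fg gf g-fix fx≡

  f-left : ∀ {j} → j < b → f (x + j) ≡ x + c + j
  f-left = run-left {f} {g} gf fg fix f-gr g-gr gx≡ fx≡ g-desc
  g-left : ∀ {j} → j < c → g (x + j) ≡ x + b + j
  g-left = run-left {g} {f} fg gf g-fix g-gr f-gr fx≡ gx≡ f-desc

  -- General in `f` and `g` in order to serve both directions. On the right block `f` undoes what
  -- `g` does on its own left block.
  inside : ∀ {f g b c} → (∀ i → g (f i) ≡ i) → (∀ i → f (g i) ≡ i) → (∀ {i} → i < x → f i ≡ i) →
    (∀ {j} → j < b → f (x + j) ≡ x + c + j) → (∀ {j} → j < c → g (x + j) ≡ x + b + j) →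
    ∀ {i} → i < x + b + c → f i ≡ blockSwap x b c i
  inside {f} {g} {b} {c} gf fg fix f-left g-left {i} i<v with region x b c i
  ... | below i<x = trans (fix i<x) (sym (blockSwap-below x b c i<x))
  ... | left j<b  = trans (f-left j<b) (sym (blockSwap-left x b c j<b))
  ... | right j<c = trans (trans (cong f (sym (g-left j<c))) (fg _)) (sym (blockSwap-right x b c j<c))
  ... | above j   = contradiction i<v (m+n≮m (x + b + c) j)

  f-inside : ∀ {i} → i < v → f i ≡ blockSwap x b c i
  f-inside = inside {f} {g} gf fg fix f-left g-left
  g-inside : ∀ {i} → i < v → g i ≡ blockSwap x c b i
  g-inside {i} i<v = inside {g} {f} fg gf g-fix g-left f-left (subst (i <_) (xy∙z≈xz∙y x b c) i<v)

  f-inc : ∀ j → f (v + j) < f (suc (v + j))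
  f-inc j = ascent {f} {g} gf f-gr f-desc λ eq → <⇒≢
    (<-≤-trans (+-monoʳ-< x (n<1+n b′)) (≤-trans (m≤m+n (x + b) c) (m≤m+n v j))) (sym eq)
  g-inc : ∀ j → g (v + j) < g (suc (v + j))
  g-inc j = ascent {g} {f} fg g-gr g-desc λ eq → <⇒≢
    (<-≤-trans (+-monoʳ-< x (n<1+n c′))
      (≤-trans (≤-trans (m≤m+n (x + c) b) (≤-reflexive (xy∙z≈xz∙y x c b))) (m≤m+n v j))) (sym eq)

  -- Below `v` the map `g` is already known to be a block swap, which keeps values below `v`; so `g`
  -- cannot send a smaller `f v` back to `v`.
  v≤f : v ≤ f v
  v≤f = ≮⇒≥ λ fv<v → contradiction (blockSwap-< x c b (≤-reflexive (xy∙z≈xz∙y x c b)) fv<v)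
    (≤⇒≯ (≤-reflexive (trans (sym (gf v)) (g-inside fv<v))))
  v≤g : v ≤ g v
  v≤g = ≮⇒≥ λ gv<v → contradiction (blockSwap-< x b c ≤-refl gv<v)
    (≤⇒≯ (≤-reflexive (trans (sym (fg v)) (f-inside gv<v))))

  -- Since `g` increases from `v` on and `v ≤ f v`, it follows that `g v ≤ g (f v) ≡ v`.
  fv≡v : f v ≡ v
  fv≡v with m≤n⇒∃[o]m+o≡n v≤f
  ... | r , v+r≡fv = trans (cong f gv≡v) (fg v)
    where
    gv≤v : g v ≤ v
    gv≤v = subst (g v ≤_) (trans (cong g v+r≡fv) (gf v)) (increasing⇒monotone {g} v g-inc r)
    gv≡v : v ≡ g v
    gv≡v = ≤-antisym v≤g gv≤v

  f≗swap : ∀ i → f i ≡ blockSwap x b c i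
  f≗swap i with i <? v
  ... | yes i<v = f-inside i<v
  ... | no  i≮v with m≤n⇒∃[o]m+o≡n (≮⇒≥ i≮v)
  -- Neither map has a descent from `v` on, so the run starting at the fixed point `v` may be taken
  -- as long as desired.
  ...   | j , refl = trans (run {f} {g} gf fg fv≡v (suc j) (λ {j} _ → f-inc j) g-inc j ≤-refl)
    (sym (blockSwap-above x b c (m≤m+n v j)))

-- Permutations that are block swaps

extend : ∀ {m} → Permutation′ m → ℕ → ℕ
extend {m} π i with i <? m
... | yes i<m = toℕ (π ⟨$⟩ʳ fromℕ< i<m)
... | no  _   = i

extend-≥ : ∀ {m} (π : Permutation′ m) {i} → m ≤ i → extend π i ≡ i
extend-≥ {m} π {i} m≤i with i <? m
... | yes i<m = contradiction m≤i (<⇒≱ i<m)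
... | no  _   = refl

extend-toℕ : ∀ {m} (π : Permutation′ m) i → extend π (toℕ i) ≡ toℕ (π ⟨$⟩ʳ i)
extend-toℕ {m} π i with toℕ i <? m
... | yes i<m = cong (toℕ ∘ (π ⟨$⟩ʳ_)) (fromℕ<-toℕ i i<m)
... | no  i≮m = contradiction (toℕ<n i) i≮m

data FinView (m : ℕ) : ℕ → Set where
  inside  : (i : Fin m) → FinView m (toℕ i)
  outside : ∀ {i} → m ≤ i → FinView m i

finView : ∀ m i → FinView m i
finView m i with i <? m
... | yes i<m = subst (FinView m) (toℕ-fromℕ< i<m) (inside (fromℕ< i<m))
... | no  i≮m = outside (≮⇒≥ i≮m)

extend-flip : ∀ {m} (π : Permutation′ m) i → extend (flip π) (extend π i) ≡ i
extend-flip {m} π i with finView m i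
... | inside i    rewrite extend-toℕ π i | extend-toℕ (flip π) (π ⟨$⟩ʳ i) = cong toℕ (inverseˡ π)
... | outside m≤i rewrite extend-≥ π m≤i = extend-≥ (flip π) m≤i

extend-flip′ : ∀ {m} (π : Permutation′ m) i → extend π (extend (flip π) i) ≡ i
extend-flip′ {m} π i with finView m i
... | inside i    rewrite extend-toℕ (flip π) i | extend-toℕ π (flip π ⟨$⟩ʳ i) = cong toℕ (inverseʳ π)
... | outside m≤i rewrite extend-≥ (flip π) m≤i = extend-≥ π m≤i

extend-descent : ∀ {m} (π : Permutation′ m) {i} → extend π (suc i) < extend π i →
  ∃[ p ] toℕ p ≡ i × IsDescent π p
extend-descent {m} π {i} desc with finView m i
... | outside m≤i rewrite extend-≥ π m≤i | extend-≥ π (m≤n⇒m≤1+n m≤i) =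
  contradiction desc (m+n≮n 1 i)
... | inside p = p , refl , helper (finView m (suc (toℕ p))) refl
  where
  -- The separate index `j` keeps the match on the view possible: `toℕ q` does not unify with
  -- `suc (toℕ p)`. The `outside` case is the border, where `extend π` takes the value `m` or more.
  helper : ∀ {j} → FinView m j → j ≡ suc (toℕ p) → IsDescent π p
  helper (outside m≤j) refl = contradiction (<-≤-trans desc′ (<⇒≤ (toℕ<n (π ⟨$⟩ʳ p)))) (≤⇒≯ m≤j)
    where desc′ = subst₂ _<_ (extend-≥ π m≤j) (extend-toℕ π p) desc
  helper (inside q) eq = q , eq ,
    subst₂ _<_ (trans (cong (extend π) (sym eq)) (extend-toℕ π q)) (extend-toℕ π p) desc

extend-atMostOneDescent : ∀ {m} (π : Permutation′ m) → Grassmannian π → AtMostOneDescent (extend π)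
extend-atMostOneDescent π gr di dj with extend-descent π di | extend-descent π dj
... | p , refl , dp | q , refl , dq = cong toℕ (gr p q dp dq)

IsBlockSwap : ∀ {m} → ℕ → ℕ → ℕ → Permutation′ m → Set
IsBlockSwap x b c π = ∀ i → toℕ (π ⟨$⟩ʳ i) ≡ blockSwap x b c (toℕ i)

biGrassmannian⇒blockSwap : ∀ {m} (π : Permutation′ m) → BiGrassmannian π → ¬ (∀ i → π ⟨$⟩ʳ i ≡ i) →
  ∃[ x ] ∃[ b ] ∃[ c ] x + suc b + suc c ≤ m × IsBlockSwap x (suc b) (suc c) π
biGrassmannian⇒blockSwap {m} π (gr , gr⁻¹) ¬id
  with p , πp≢p , fix ← Fin.¬∀⟶∃¬-smallest m (λ i → π ⟨$⟩ʳ i ≡ i) (λ i → π ⟨$⟩ʳ i Fin.≟ i) ¬id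
  with atMostOneDescent⇒blockSwap {extend π} {extend (flip π)} (extend-flip π) (extend-flip′ π)
         (extend-atMostOneDescent π gr) (extend-atMostOneDescent (flip π) gr⁻¹)
         {toℕ p} (λ i<p → let q = fromℕ< i<p ; eq = trans (toℕ-inject q) (toℕ-fromℕ< i<p) in
           trans (cong (extend π) (sym eq)) (trans (extend-toℕ π (inject q)) (trans (cong toℕ (fix q)) eq)))
         (λ eq → πp≢p (toℕ-injective (trans (sym (extend-toℕ π p)) eq)))
... | b , c , eq = toℕ p , b , c , ≮⇒≥ v≯m , λ i → trans (sym (extend-toℕ π i)) (eq (toℕ i))
  where
  x = toℕ p
  -- Otherwise `x + suc b + c`, the last point of the right block, would lie at or beyond `m`; the
  -- extension fixes it, but the swap moves it to `x + c`.
  v≯m : ¬ m < x + suc b + suc c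
  v≯m m<v = <⇒≢ (+-monoˡ-< c (m<m+n x z<s)) (begin
    x + c                                        ≡⟨ blockSwap-right x (suc b) (suc c) ≤-refl ⟨
    blockSwap x (suc b) (suc c) (x + suc b + c)  ≡⟨ eq _ ⟨
    extend π (x + suc b + c)                     ≡⟨ extend-≥ π (≤-pred (subst (m <_) (+-suc (x + suc b) c) m<v)) ⟩
    x + suc b + c                                ∎)
    where open ≡-Reasoning

blockSwapPermutation : ∀ {m} x b c → x + b + c ≤ m → Permutation′ m
blockSwapPermutation {m} x b c v≤m =
  mk↔ₛ′ (swap b c v≤m) (swap c b v′≤m) (inv c b v′≤m v≤m) (inv b c v≤m v′≤m)
  where
  v′≤m = subst (_≤ m) (xy∙z≈xz∙y x b c) v≤m
  swap : ∀ b c → x + b + c ≤ m → Fin m → Fin m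
  swap b c v≤m i = fromℕ< (blockSwap-< x b c v≤m (toℕ<n i))
  inv : ∀ b c (p : x + b + c ≤ m) (q : x + c + b ≤ m) i → swap c b q (swap b c p i) ≡ i
  inv b c p q i = toℕ-injective (begin
    toℕ (swap c b q (swap b c p i))          ≡⟨ toℕ-fromℕ< _ ⟩
    blockSwap x c b (toℕ (swap b c p i))     ≡⟨ cong (blockSwap x c b) (toℕ-fromℕ< _) ⟩
    blockSwap x c b (blockSwap x b c (toℕ i)) ≡⟨ blockSwap-inverse x b c (toℕ i) ⟩
    toℕ i                                    ∎)
    where open ≡-Reasoning

blockSwapPermutation-isBlockSwap : ∀ {m} x b c (v≤m : x + b + c ≤ m) →
  IsBlockSwap x b c (blockSwapPermutation x b c v≤m)
blockSwapPermutation-isBlockSwap x b c v≤m i = toℕ-fromℕ< _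

-- Carries an agreement on `Fin m` over to ℕ, where `blockSwap-injective` applies: from `m` on both
-- swaps are the identity.
extensional-isBlockSwap : ∀ {m} x b c x′ b′ c′ (π : Permutation′ m) →
  x + b + c ≤ m → x′ + b′ + c′ ≤ m → IsBlockSwap x b c π → IsBlockSwap x′ b′ c′ π →
  ∀ i → blockSwap x b c i ≡ blockSwap x′ b′ c′ i
extensional-isBlockSwap {m} x b c x′ b′ c′ π v≤m v′≤m s s′ i with finView m i
... | inside i    = trans (sym (s i)) (s′ i)
... | outside m≤i = trans (blockSwap-above x b c (≤-trans v≤m m≤i)) (sym (blockSwap-above x′ b′ c′ (≤-trans v′≤m m≤i)))

module _ {m : ℕ} (x b c : ℕ) (π : Permutation′ m) (s : IsBlockSwap x b c π) where

  flip-isBlockSwap : IsBlockSwap x c b (flip π)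
  flip-isBlockSwap i = begin
    toℕ (flip π ⟨$⟩ʳ i)                                       ≡⟨ blockSwap-inverse x b c _ ⟨
    blockSwap x c b (blockSwap x b c (toℕ (flip π ⟨$⟩ʳ i)))   ≡⟨ cong (blockSwap x c b) (s _) ⟨
    blockSwap x c b (toℕ (π ⟨$⟩ʳ (flip π ⟨$⟩ʳ i)))            ≡⟨ cong (blockSwap x c b ∘ toℕ) (inverseʳ π) ⟩
    blockSwap x c b (toℕ i)                                   ∎
    where open ≡-Reasoning

  -- A descent is an inversion of neighbours, so it must straddle the border between the blocks at
  -- `x + b`.
  isBlockSwap⇒grassmannian : Grassmannian π
  isBlockSwap⇒grassmannian i j di dj =
    toℕ-injective (suc-injective (trans (position di) (sym (position dj))))
    where
    position : ∀ {i} → IsDescent π i → suc (toℕ i) ≡ x + b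
    position {i} (j , j≡1+i , desc) with blockSwap-inversion x b c {toℕ i} {toℕ j}
      (≤-reflexive (sym j≡1+i)) (subst₂ _<_ (s j) (s i) desc)
    ... | (_ , i<x+b) , (x+b≤j , _) = ≤-antisym i<x+b (subst (x + b ≤_) j≡1+i x+b≤j)

-- Increasing subsequences of block swaps

-- Closing the gap keeps the sequence strictly increasing, so it becomes an injection of `Fin k`
-- into the `t` points before and the `r` points after the gap.
strictlyIncreasing-outsideGap : ∀ {k} t l r (h : Fin k → ℕ) → (∀ {i j} → i Fin.< j → h i < h j) →
  (∀ i → OutsideGap t l (h i)) → (∀ i → h i < t + r + l) → k ≤ t + r
strictlyIncreasing-outsideGap t l r h inc out h<n =
  Fin.injective⇒≤ {f = λ i → fromℕ< (squash-< t l r (out i) (h<n i))} λ {i} {j} eq → injective i j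
    (trans (sym (toℕ-fromℕ< _)) (trans (cong toℕ eq) (toℕ-fromℕ< _)))
  where
  squash-inc : ∀ {i j} → i Fin.< j → squash t l (h i) < squash t l (h j)
  squash-inc {i} {j} i<j = squash-mono-< t l (out i) (out j) (inc i<j)
  injective : ∀ i j → squash t l (h i) ≡ squash t l (h j) → i ≡ j
  injective i j eq with Fin.<-cmp i j
  ... | tri< i<j _ _ = contradiction eq (<⇒≢ (squash-inc i<j))
  ... | tri≈ _ i≡j _ = i≡j
  ... | tri> _ _ j<i = contradiction (sym eq) (<⇒≢ (squash-inc j<i))

module _ {m : ℕ} (x b c : ℕ) (π : Permutation′ m) (s : IsBlockSwap x b c π) where

  private
    contains : ∀ {k} u w l → k + l ≤ m →
      (∀ i → blockSwap x b c (skip u l i) ≡ skip w l i) → ¬ AvoidsId k π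
    contains {k} u w l k+l≤m eq avoids = avoids (f , f-inc , πf-inc)
      where
      f : Fin k → Fin m
      f i = fromℕ< (<-≤-trans (skip-< u l (toℕ<n i)) k+l≤m)
      f≡ : ∀ i → toℕ (f i) ≡ skip u l (toℕ i)
      f≡ i = toℕ-fromℕ< _
      πf≡ : ∀ i → toℕ (π ⟨$⟩ʳ f i) ≡ skip w l (toℕ i)
      πf≡ i = trans (s (f i)) (trans (cong (blockSwap x b c) (f≡ i)) (eq (toℕ i)))
      f-inc : StrictlyIncreasing f
      f-inc {i} {j} i<j = subst₂ _<_ (sym (f≡ i)) (sym (f≡ j)) (skip-mono-< u l i<j)
      πf-inc : StrictlyIncreasing (λ i → π ⟨$⟩ʳ f i)
      πf-inc {i} {j} i<j = subst₂ _<_ (sym (πf≡ i)) (sym (πf≡ j)) (skip-mono-< w l i<j)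

  -- Omitting either block leaves an increasing subsequence, of length `m - b` or `m - c`, so `k`
  -- must exceed both.
  avoids⇒blocks-large : ∀ {k} → AvoidsId k π → m < k + b × m < k + c
  avoids⇒blocks-large avoids =
    ≰⇒> (λ le → contains x (x + c) b le (blockSwap-skip-left x b c) avoids) ,
    ≰⇒> (λ le → contains (x + b) x c le (blockSwap-skip-right x b c) avoids)

  -- An increasing subsequence cannot meet both blocks.
  blocks-large⇒avoids : ∀ {k} → x + b + c ≤ m → m < k + b → m < k + c → AvoidsId k π
  blocks-large⇒avoids {k} v≤m m<k+b m<k+c (f , f-inc , πf-inc)
    with y , refl ← m≤n⇒∃[o]m+o≡n v≤m
    with Fin.any? (λ p → (x ≤? toℕ (f p)) ×-dec (toℕ (f p) <? x + b))
  ... | yes (p , x≤fp , fp<x+b) = contradiction m<k+c (≤⇒≯ (begin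
    k + c            ≤⟨ +-monoˡ-≤ c (strictlyIncreasing-outsideGap (x + b) c y (toℕ ∘ f) f-inc out
                          (λ i → subst (toℕ (f i) <_) (xy∙z≈xz∙y (x + b) c y) (toℕ<n (f i)))) ⟩
    x + b + y + c    ≡⟨ xy∙z≈xz∙y (x + b) y c ⟩
    x + b + c + y    ∎))
    where
    open ≤-Reasoning
    out : ∀ i → OutsideGap (x + b) c (toℕ (f i))
    out i with toℕ (f i) <? x + b | x + b + c ≤? toℕ (f i)
    ... | yes lt | _     = inj₁ lt
    ... | no  _  | yes le = inj₂ le
    -- A position in the right block would form an inversion with the position of `p` in the left
    -- block: if it comes later in the subsequence, its value is too small, and it cannot come
    -- earlier.
    ... | no  ≮  | no ≰  with inverted ← blockSwap-inverts x b c x≤fp fp<x+b (≮⇒≥ ≮) (≰⇒> ≰)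
      with Fin.<-cmp p i
    ...   | tri< p<i _ _ = contradiction (subst₂ _<_ (s (f p)) (s (f i)) (πf-inc p<i)) (<-asym inverted)
    ...   | tri≈ _ refl _ = inj₁ fp<x+b
    ...   | tri> _ _ i<p = contradiction (<-trans (f-inc i<p) fp<x+b) ≮
  -- Now the subsequence misses the left block, which becomes the gap; `c + y` points follow it.
  ... | no ∄p = contradiction m<k+b (≤⇒≯ (begin
    k + b              ≤⟨ +-monoˡ-≤ b (strictlyIncreasing-outsideGap x b (c + y) (toℕ ∘ f) f-inc out
                            (λ i → subst (toℕ (f i) <_) (regroup x b c y) (toℕ<n (f i)))) ⟩
    x + (c + y) + b    ≡⟨ regroup x b c y ⟨
    x + b + c + y      ∎))
    where
    open ≤-Reasoning
    regroup : ∀ x b c y → x + b + c + y ≡ x + (c + y) + b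
    regroup = solve-∀
    out : ∀ i → OutsideGap x b (toℕ (f i))
    out i with toℕ (f i) <? x | x + b ≤? toℕ (f i)
    ... | yes lt | _      = inj₁ lt
    ... | no  _  | yes le = inj₂ le
    ... | no  ≮  | no ≰   = contradiction (i , ≮⇒≥ ≮ , ≰⇒> ≰) ∄p

-- Inversions of block swaps

length-filter-map : ∀ {A B : Set} {P : B → Set} {Q : A → Set} (P? : Decidable P) (Q? : Decidable Q) (f : A → B) →
  (∀ {x} → P (f x) → Q x) → (∀ {x} → Q x → P (f x)) →
  ∀ xs → length (filter P? (map f xs)) ≡ length (filter Q? xs)
length-filter-map P? Q? f to from []       = refl
length-filter-map P? Q? f to from (x ∷ xs) with ih ← length-filter-map P? Q? f to from xs | Q? x
... | yes qx rewrite filter-accept P? {f x} {map f xs} (from qx) = cong suc ih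
... | no ¬qx rewrite filter-reject P? {f x} {map f xs} (¬qx ∘ to) = ih

module _ {A B : Set} {P : A → Set} {Q : B → Set} (P? : Decidable P) (Q? : Decidable Q) where

  length-filter-cartesianProduct : ∀ xs ys →
    length (filter (λ (x , y) → P? x ×-dec Q? y) (cartesianProduct xs ys)) ≡
    length (filter P? xs) * length (filter Q? ys)
  length-filter-cartesianProduct []       ys = refl
  length-filter-cartesianProduct (x ∷ xs) ys = begin
    length (filter PQ? (map (x ,_) ys ++ cartesianProduct xs ys))
      ≡⟨ cong length (filter-++ PQ? (map (x ,_) ys) _) ⟩
    length (filter PQ? (map (x ,_) ys) ++ filter PQ? (cartesianProduct xs ys))
      ≡⟨ length-++ (filter PQ? (map (x ,_) ys)) ⟩
    length (filter PQ? (map (x ,_) ys)) + length (filter PQ? (cartesianProduct xs ys))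
      ≡⟨ cong (length (filter PQ? (map (x ,_) ys)) +_) (length-filter-cartesianProduct xs ys) ⟩
    length (filter PQ? (map (x ,_) ys)) + length (filter P? xs) * length (filter Q? ys)
      ≡⟨ row ⟩
    length (filter P? (x ∷ xs)) * length (filter Q? ys) ∎
    where
    open ≡-Reasoning
    PQ? = λ (x , y) → P? x ×-dec Q? y
    hit : P x → ∀ ys → length (filter PQ? (map (x ,_) ys)) ≡ length (filter Q? ys)
    hit px = length-filter-map PQ? Q? (x ,_) proj₂ (px ,_)
    miss : ¬ P x → ∀ ys → length (filter PQ? (map (x ,_) ys)) ≡ 0
    miss ¬px []       = refl
    miss ¬px (y ∷ ys) rewrite filter-reject PQ? {x , y} {map (x ,_) ys} (¬px ∘ proj₁) = miss ¬px ys
    row : length (filter PQ? (map (x ,_) ys)) + length (filter P? xs) * length (filter Q? ys) ≡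
          length (filter P? (x ∷ xs)) * length (filter Q? ys)
    row with P? x
    ... | yes px = cong (_+ _) (hit px ys)
    ... | no ¬px = cong (_+ _) (miss ¬px ys)

InInterval : ∀ {m} → ℕ → ℕ → Fin m → Set
InInterval t l i = t ≤ toℕ i × toℕ i < t + l

inInterval? : ∀ {m} t l → Decidable (InInterval {m} t l)
inInterval? t l i = (t ≤? toℕ i) ×-dec (toℕ i <? t + l)

-- Induction on `m` shifts the interval down by one; `map-tabulate` turns the tail of
-- `allFin (suc m)` into `map Fin.suc (allFin m)`.
length-filter-inInterval : ∀ m t l → t + l ≤ m → length (filter (inInterval? t l) (allFin m)) ≡ l
length-filter-inInterval zero    zero    zero    le = refl
length-filter-inInterval (suc m) zero    zero    le = trans
  (cong (length ∘ filter _) (sym (map-tabulate {n = m} (λ i → i) Fin.suc)))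
  (trans (length-filter-map (inInterval? {suc m} 0 0) (inInterval? {m} 0 0) Fin.suc (λ { (_ , ()) }) (λ { (_ , ()) }) (allFin m))
    (length-filter-inInterval m 0 0 z≤n))
length-filter-inInterval (suc m) zero    (suc l) (s≤s le) = cong suc (trans
  (cong (length ∘ filter _) (sym (map-tabulate {n = m} (λ i → i) Fin.suc)))
  (trans (length-filter-map (inInterval? {suc m} 0 (suc l)) (inInterval? {m} 0 l) Fin.suc
      (λ { (_ , s≤s p) → z≤n , p }) (λ { (_ , p) → z≤n , s≤s p }) (allFin m))
    (length-filter-inInterval m 0 l le)))
length-filter-inInterval (suc m) (suc t) l       (s≤s le) = trans
  (cong (length ∘ filter _) (sym (map-tabulate {n = m} (λ i → i) Fin.suc)))
  (trans (length-filter-map (inInterval? {suc m} (suc t) l) (inInterval? {m} t l) Fin.suc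
      (λ { (s≤s p , s≤s q) → p , q }) (λ { (p , q) → s≤s p , s≤s q }) (allFin m))
    (length-filter-inInterval m t l le))

length-inversions : ∀ {m} x b c (π : Permutation′ m) → x + b + c ≤ m → IsBlockSwap x b c π →
  length (inversions π) ≡ b * c
length-inversions {m} x b c π v≤m s = begin
  length (inversions π)
    ≡⟨ cong length (filter-≐ (isInversion? π) (λ (i , j) → inInterval? x b i ×-dec inInterval? (x + b) c j)
         (to , from) (cartesianProduct (allFin m) (allFin m))) ⟩
  length (filter _ (cartesianProduct (allFin m) (allFin m)))
    ≡⟨ length-filter-cartesianProduct (inInterval? x b) (inInterval? (x + b) c) (allFin m) (allFin m) ⟩
  length (filter (inInterval? x b) (allFin m)) * length (filter (inInterval? (x + b) c) (allFin m))
    ≡⟨ cong₂ _*_ (length-filter-inInterval m x b (≤-trans (m≤m+n (x + b) c) v≤m)) (length-filter-inInterval m (x + b) c v≤m) ⟩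
  b * c ∎
  where
  open ≡-Reasoning
  to : ∀ {p} → IsInversion π p → InInterval x b (proj₁ p) × InInterval (x + b) c (proj₂ p)
  to {i , j} (i<j , inv) = blockSwap-inversion x b c i<j (subst₂ _<_ (s j) (s i) inv)
  from : ∀ {p} → InInterval x b (proj₁ p) × InInterval (x + b) c (proj₂ p) → IsInversion π p
  from {i , j} ((x≤i , i<x+b) , (x+b≤j , j<v)) = <-≤-trans i<x+b x+b≤j ,
    subst₂ _<_ (sym (s j)) (sym (s i)) (blockSwap-inverts x b c x≤i i<x+b x+b≤j j<v)

odd⇒≢id : ∀ {m} (π : Permutation′ m) → OddPermutation π → ¬ (∀ i → π ⟨$⟩ʳ i ≡ i)
odd⇒≢id {m} π odd id with subst (λ ps → Odd (length ps)) (filter-none (isInversion? π)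
  (universal (λ (i , j) (i<j , inv) → <-asym i<j (subst₂ Fin._<_ (id j) (id i) inv)) (cartesianProduct (allFin m) (allFin m)))) odd
... | ()

-- Counting the solutions of x + y + 2 i + 2 j = n

-- The elements of S (n - 2 i), for 2 i ≤ n.
data Layered (S : ℕ → Set) : ℕ → Set where
  base : ∀ {n} → S n → Layered S n
  up   : ∀ {n} → Layered S n → Layered S (2 + n)

layeredSum : (ℕ → ℕ) → ℕ → ℕ
layeredSum s 0             = s 0
layeredSum s 1             = s 1
layeredSum s (suc (suc n)) = s (suc (suc n)) + layeredSum s n

module _ {S : ℕ → Set} where

  layered↔Fin : ∀ {s} → (∀ n → S n ↔ Fin (s n)) → ∀ n → Layered S n ↔ Fin (layeredSum s n)
  layered↔Fin S↔ 0 = S↔ 0 ↔-∘ mk↔ₛ′ (λ { (base t) → t }) base (λ _ → refl) (λ { (base _) → refl })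
  layered↔Fin S↔ 1 = S↔ 1 ↔-∘ mk↔ₛ′ (λ { (base t) → t }) base (λ _ → refl) (λ { (base _) → refl })
  layered↔Fin S↔ (suc (suc n)) = (↔-sym +↔⊎ ↔-∘ (S↔ (2 + n) ⊎-↔ layered↔Fin S↔ n)) ↔-∘
    mk↔ₛ′ (λ { (base t) → inj₁ t ; (up t) → inj₂ t }) (λ { (inj₁ t) → base t ; (inj₂ t) → up t })
      (λ { (inj₁ _) → refl ; (inj₂ _) → refl }) (λ { (base _) → refl ; (up _) → refl })

  raise : ∀ i {r} → S r → Layered S (i * 2 + r)
  raise zero    t = base t
  raise (suc i) t = up (raise i t)

  height : ∀ {n} → Layered S n → ℕ
  height (base _) = 0
  height (up t)   = suc (height t)

  height-raise : ∀ i {r} (t : S r) → height (raise i t) ≡ i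
  height-raise zero    t = refl
  height-raise (suc i) t = cong suc (height-raise i t)

  module _ {A : Set} (φ : ∀ {r} → S r → A) where

    label : ∀ {n} → Layered S n → A
    label (base t) = φ t
    label (up t)   = label t

    -- The height fixes the shape of the term, and with it the index of the base element, which `φ`
    -- then determines.
    height-label-injective : (∀ {r} {t u : S r} → φ t ≡ φ u → t ≡ u) →
      ∀ {n} {t u : Layered S n} → height t ≡ height u → label t ≡ label u → t ≡ u
    height-label-injective φ-inj {t = base _} {base _} _  eq = cong base (φ-inj eq)
    height-label-injective φ-inj {t = up _}   {up _}   hs eq =
      cong up (height-label-injective φ-inj (suc-injective hs) eq)

    label-raise : ∀ i {r} (t : S r) → label (raise i t) ≡ φ t
    label-raise zero    t = refl
    label-raise (suc i) t = label-raise i t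

-- The solutions of x + y + 2 i + 2 j = n; the element of Fin (suc r) is x, and y = r - x.
Quadruple : ℕ → Set
Quadruple = Layered (Layered (Fin ∘ suc))

quadrupleCount : ℕ → ℕ
quadrupleCount = layeredSum (layeredSum suc)

quadruple↔Fin : ∀ n → Quadruple n ↔ Fin (quadrupleCount n)
quadruple↔Fin = layered↔Fin (layered↔Fin λ n → ↔-id _)

module _ {n : ℕ} where

  quadⱼ quadᵢ quadₓ : Quadruple n → ℕ
  quadⱼ = height
  quadᵢ = label height
  quadₓ = label (label toℕ)

  quad-injective : ∀ {t u : Quadruple n} →
    quadₓ t ≡ quadₓ u → quadᵢ t ≡ quadᵢ u → quadⱼ t ≡ quadⱼ u → t ≡ u
  quad-injective {t} {u} xs is js = height-label-injective (λ t → height t , label toℕ t)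
    (λ eq → height-label-injective toℕ toℕ-injective (cong proj₁ eq) (cong proj₂ eq)) js
    (trans (pair t) (trans (cong₂ _,_ is xs) (sym (pair u))))
    where
    pair : ∀ {n} (t : Quadruple n) →
      label (λ t → height t , label toℕ t) t ≡ (label height t , label (label toℕ) t)
    pair (base t) = refl
    pair (up t)   = pair t

quad-sum : ∀ {n} (t : Quadruple n) → ∃[ y ] quadⱼ t * 2 + (quadᵢ t * 2 + (quadₓ t + y)) ≡ n
quad-sum (up t) with quad-sum t
... | y , eq = y , cong (2 +_) eq
quad-sum (base (up t)) with quad-sum (base t)
... | y , eq = y , cong (2 +_) eq
quad-sum (base (base p)) = m≤n⇒∃[o]m+o≡n (≤-pred (toℕ<n p))

quad-surjective : ∀ {n} x i j y → j * 2 + (i * 2 + (x + y)) ≡ n →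
  ∃[ t ] quadₓ {n} t ≡ x × quadᵢ t ≡ i × quadⱼ t ≡ j
quad-surjective x i j y refl =
  raise j (raise i p) ,
  trans (label-raise (label toℕ) j (raise i p)) (trans (label-raise toℕ i p) (toℕ-fromℕ< _)) ,
  trans (label-raise height j (raise i p)) (height-raise i p) ,
  height-raise j (raise i p)
  where
  p : Fin (suc (x + y))
  p = fromℕ< (s≤s (m≤m+n x y))

even⇒double : ∀ n → Even n → ∃[ i ] n ≡ i * 2
even⇒double 0             _  = 0 , refl
even⇒double (suc (suc n)) ev with even⇒double n ev
... | i , refl = suc i , refl

suc-even : ∀ n → Even n → Odd (suc n)
suc-even n ev = trans (sym (suc-homo-⁻¹ (suc n))) (cong ℙ._⁻¹ ev)

suc-odd : ∀ n → Odd n → Even (suc n)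
suc-odd n od = trans (sym (suc-homo-⁻¹ (suc n))) (cong ℙ._⁻¹ od)

pred-odd : ∀ n → Odd (suc n) → Even n
pred-odd n od = trans (sym (suc-homo-⁻¹ n)) (cong ℙ._⁻¹ od)

double-even : ∀ i → Even (i * 2)
double-even zero    = refl
double-even (suc i) = double-even i

even-+ : ∀ m n → Even m → parity (m + n) ≡ parity n
even-+ m n ev = trans (+-homo-+ m n) (cong (ℙ._+ parity n) ev)

odd-* : ∀ m n → Odd (m * n) → Odd m × Odd n
odd-* m n od with parity m | parity n | trans (sym od) (*-homo-* m n)
... | 1ℙ | 1ℙ | _ = refl , refl

*-odd : ∀ m n → Odd m → Odd n → Odd (m * n)
*-odd m n om on = trans (*-homo-* m n) (cong₂ ℙ._*_ om on)

odd-above-even : ∀ {e b} → Even e → Odd b → e < b → ∃[ i ] b ≡ suc (i * 2 + e)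
odd-above-even {e} {b} ev od e<b with m≤n⇒∃[o]m+o≡n e<b
... | o , refl with even⇒double o (trans (sym (even-+ e o ev)) (pred-odd (e + o) od))
... | i , refl = i , cong suc (+-comm e (i * 2))

enumeration⇒inverse : (T : Setoid 0ℓ 0ℓ) {B : Set} → let open Setoid T in (from : B → Carrier) →
  (∀ {t u} → from t ≈ from u → t ≡ u) → (∀ s → ∃[ t ] from t ≈ s) → Inverse T (setoid B)
enumeration⇒inverse T from inj surj = record
  { to        = λ s → proj₁ (surj s)
  ; from      = from
  ; to-cong   = λ {s} {s′} s≈s′ → inj (T.trans (proj₂ (surj s)) (T.trans s≈s′ (T.sym (proj₂ (surj s′)))))
  ; from-cong = λ { refl → T.refl }
  ; inverse   = (λ {t} {s} s≈ → inj (T.trans (proj₂ (surj s)) s≈)) ,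
                (λ { {s} refl → proj₂ (surj s) })
  }
  where module T = Setoid T

record Threshold (k m e : ℕ) : Set where
  field
    isEven      : Even e
    large⇒above : ∀ {b} → Odd b → m < k + b → e < b
    above⇒large : ∀ {b} → Odd b → e < b → m < k + b

module _ {k m e : ℕ} (threshold : Threshold k m e) where

  open Threshold threshold

  private
    size : ℕ → ℕ
    size i = suc (i * 2 + e)

    size-odd : ∀ i → Odd (size i)
    size-odd i = suc-even (i * 2 + e) (trans (even-+ (i * 2) e (double-even i)) isEven)

    e<size : ∀ i → e < size i
    e<size i = s≤s (m≤n+m e (i * 2))

    size-injective : ∀ {i i′} → i * 2 + e ≡ i′ * 2 + e → i ≡ i′
    size-injective {i} {i′} eq = *-cancelʳ-≡ i i′ 2 (+-cancelʳ-≡ e _ _ eq)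

  blockSwap⇒oddBiGrassmannian : ∀ x i j (π : Permutation′ m) → x + size i + size j ≤ m →
    IsBlockSwap x (size i) (size j) π → OddBiGrassmannianAvoiding k π
  blockSwap⇒oddBiGrassmannian x i j π v≤m s =
    subst Odd (sym (length-inversions x (size i) (size j) π v≤m s))
      (*-odd (size i) (size j) (size-odd i) (size-odd j)) ,
    (isBlockSwap⇒grassmannian x (size i) (size j) π s ,
     isBlockSwap⇒grassmannian x (size j) (size i) (flip π) (flip-isBlockSwap x (size i) (size j) π s)) ,
    blocks-large⇒avoids x (size i) (size j) π s v≤m
      (above⇒large (size-odd i) (e<size i)) (above⇒large (size-odd j) (e<size j))

  oddBiGrassmannian⇒blockSwap : (π : Permutation′ m) → OddBiGrassmannianAvoiding k π →
    ∃[ x ] ∃[ i ] ∃[ j ] x + size i + size j ≤ m × IsBlockSwap x (size i) (size j) π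
  oddBiGrassmannian⇒blockSwap π (odd , bi , avoids) =
    let x , b , c , v≤m , s = biGrassmannian⇒blockSwap π bi (odd⇒≢id π odd)
        m<k+b , m<k+c       = avoids⇒blocks-large x (suc b) (suc c) π s avoids
        odd-b , odd-c       = odd-* (suc b) (suc c)
                                (subst Odd (length-inversions x (suc b) (suc c) π v≤m s) odd)
        i , b≡              = odd-above-even isEven odd-b (large⇒above odd-b m<k+b)
        j , c≡              = odd-above-even isEven odd-c (large⇒above odd-c m<k+c)
    in x , i , j , subst₂ (λ b c → x + b + c ≤ m) b≡ c≡ v≤m ,
       subst₂ (λ b c → IsBlockSwap x b c π) b≡ c≡ s

  cardinality-zero : m < 2 + (e + e) → HasCardinality (PermutationsWith {m} (OddBiGrassmannianAvoiding k)) 0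
  cardinality-zero m<2+2e = enumeration⇒inverse _ (λ ()) (λ { {()} }) λ (π , good) →
    let x , i , j , v≤m , _ = oddBiGrassmannian⇒blockSwap π good in
    contradiction m<2+2e (≤⇒≯ (≤-trans (≤-trans (m≤n+m _ (x + i * 2 + j * 2)) (≤-reflexive (regroup x i j e))) v≤m))
    where
    regroup : ∀ x i j e → x + i * 2 + j * 2 + (2 + (e + e)) ≡ x + suc (i * 2 + e) + suc (j * 2 + e)
    regroup = solve-∀

  cardinality : ∀ {n} → m ≡ 2 + (e + e) + n →
    HasCardinality (PermutationsWith {m} (OddBiGrassmannianAvoiding k)) (quadrupleCount n)
  cardinality {n} m≡ = quadruple↔Fin n ∘′ enumeration⇒inverse _ enumerate injective surjective
    where
    _∘′_ : ∀ {T : Setoid 0ℓ 0ℓ} {A B : Set} → A ↔ B → Inverse T (setoid A) → Inverse T (setoid B)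
    f ∘′ g = g ∘-inverse f
    regroup : ∀ x i j e y → x + suc (i * 2 + e) + suc (j * 2 + e) + y ≡ 2 + (e + e) + (j * 2 + (i * 2 + (x + y)))
    regroup = solve-∀
    fits : (t : Quadruple n) → quadₓ t + size (quadᵢ t) + size (quadⱼ t) ≤ m
    fits t with y , eq ← quad-sum t = ≤-trans (m≤m+n _ y) (≤-reflexive
      (trans (regroup (quadₓ t) (quadᵢ t) (quadⱼ t) e y) (trans (cong (2 + (e + e) +_) eq) (sym m≡))))
    perm : Quadruple n → Permutation′ m
    perm t = blockSwapPermutation (quadₓ t) (size (quadᵢ t)) (size (quadⱼ t)) (fits t)
    perm-isBlockSwap : ∀ t → IsBlockSwap (quadₓ t) (size (quadᵢ t)) (size (quadⱼ t)) (perm t)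
    perm-isBlockSwap t = blockSwapPermutation-isBlockSwap (quadₓ t) (size (quadᵢ t)) (size (quadⱼ t)) (fits t)
    enumerate : Quadruple n → Σ (Permutation′ m) (OddBiGrassmannianAvoiding k)
    enumerate t = perm t ,
      blockSwap⇒oddBiGrassmannian (quadₓ t) (quadᵢ t) (quadⱼ t) (perm t) (fits t) (perm-isBlockSwap t)
    injective : ∀ {t u} → (∀ i → perm t ⟨$⟩ʳ i ≡ perm u ⟨$⟩ʳ i) → t ≡ u
    injective {t} {u} eq =
      let xs , is , js = blockSwap-injective (quadₓ t) _ _ (quadₓ u) _ _
            (extensional-isBlockSwap (quadₓ t) _ _ (quadₓ u) _ _ (perm u) (fits t) (fits u)
              (λ i → trans (cong toℕ (sym (eq i))) (perm-isBlockSwap t i)) (perm-isBlockSwap u))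
      in quad-injective xs (size-injective is) (size-injective js)
    realise : ∀ (π : Permutation′ m) {x i j} → IsBlockSwap x (size i) (size j) π →
      ∀ t → quadₓ t ≡ x × quadᵢ t ≡ i × quadⱼ t ≡ j → ∀ p → perm t ⟨$⟩ʳ p ≡ π ⟨$⟩ʳ p
    realise π s t (refl , refl , refl) p = toℕ-injective (trans (perm-isBlockSwap t p) (sym (s p)))
    surjective : ∀ (s : Σ (Permutation′ m) (OddBiGrassmannianAvoiding k)) →
      ∃[ t ] ∀ i → perm t ⟨$⟩ʳ i ≡ proj₁ s ⟨$⟩ʳ i
    surjective (π , good) =
      let x , i , j , v≤m , s = oddBiGrassmannian⇒blockSwap π good
          y , eq              = m≤n⇒∃[o]m+o≡n v≤m
          t , coordinates     = quad-surjective x i j y (+-cancelˡ-≡ (2 + (e + e)) _ _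
                                  (trans (sym (regroup x i j e y)) (trans eq m≡)))
      in t , realise π s t coordinates

-- The closed formula

open import Data.Integer.Base as ℤ using (+_; _-_)

6*[n+2]C3 : ∀ n → 6 * ((2 + n) C 3) ≡ n * (1 + n) * (2 + n)
6*[n+2]C3 zero    = refl
6*[n+2]C3 (suc n) = begin
  6 * ((3 + n) C 3)                            ≡⟨ cong (6 *_) (nCk+nC[k+1]≡[n+1]C[k+1] (2 + n) 2) ⟨
  6 * ((2 + n) C 2 + (2 + n) C 3)              ≡⟨ split ((2 + n) C 2) ((2 + n) C 3) ⟩
  3 * (2 * ((2 + n) C 2)) + 6 * ((2 + n) C 3)  ≡⟨ cong₂ _+_ (cong (3 *_) (2*[n+1]C2 (suc n))) (6*[n+2]C3 n) ⟩
  3 * ((1 + n) * (2 + n)) + n * (1 + n) * (2 + n) ≡⟨ collect n ⟩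
  suc n * (1 + suc n) * (2 + suc n)            ∎
  where
  open ≡-Reasoning
  split : ∀ p q → 6 * (p + q) ≡ 3 * (2 * p) + 6 * q
  split = solve-∀
  collect : ∀ n → 3 * ((1 + n) * (2 + n)) + n * (1 + n) * (2 + n) ≡ suc n * (1 + suc n) * (2 + suc n)
  collect = solve-∀
  2*[n+1]C2 : ∀ n → 2 * ((1 + n) C 2) ≡ n * (1 + n)
  2*[n+1]C2 zero    = refl
  2*[n+1]C2 (suc n) = begin
    2 * ((2 + n) C 2)                        ≡⟨ cong (2 *_) (nCk+nC[k+1]≡[n+1]C[k+1] (1 + n) 1) ⟨
    2 * ((1 + n) C 1 + (1 + n) C 2)          ≡⟨ *-distribˡ-+ 2 ((1 + n) C 1) _ ⟩
    2 * ((1 + n) C 1) + 2 * ((1 + n) C 2)    ≡⟨ cong₂ _+_ (cong (2 *_) (nC1≡n (1 + n))) (2*[n+1]C2 n) ⟩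
    2 * (1 + n) + n * (1 + n)                ≡⟨ collect₂ n ⟩
    suc n * (1 + suc n)                      ∎
    where
    collect₂ : ∀ n → 2 * (1 + n) + n * (1 + n) ≡ suc n * (1 + suc n)
    collect₂ = solve-∀

tripleCount-even : ∀ r → layeredSum suc (r * 2) ≡ (1 + r) * (1 + r)
tripleCount-even zero    = refl
tripleCount-even (suc r) = trans (cong (λ u → suc (2 + r * 2) + u) (tripleCount-even r)) (collect r)
  where
  collect : ∀ r → suc (2 + r * 2) + (1 + r) * (1 + r) ≡ (1 + suc r) * (1 + suc r)
  collect = solve-∀

tripleCount-odd : ∀ r → layeredSum suc (1 + r * 2) ≡ (1 + r) * (2 + r)
tripleCount-odd zero    = refl
tripleCount-odd (suc r) = trans (cong (λ u → suc (3 + r * 2) + u) (tripleCount-odd r)) (collect r)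
  where
  collect : ∀ r → suc (3 + r * 2) + (1 + r) * (2 + r) ≡ (1 + suc r) * (2 + suc r)
  collect = solve-∀

quadrupleCount-even : ∀ r → 6 * quadrupleCount (r * 2) ≡ (1 + r) * (2 + r) * (3 + r * 2)
quadrupleCount-even zero    = refl
quadrupleCount-even (suc r) = begin
  6 * (layeredSum suc (2 + r * 2) + quadrupleCount (r * 2))     ≡⟨ *-distribˡ-+ 6 (layeredSum suc (2 + r * 2)) _ ⟩
  6 * layeredSum suc (2 + r * 2) + 6 * quadrupleCount (r * 2)   ≡⟨ cong₂ _+_ (cong (6 *_) (tripleCount-even (suc r))) (quadrupleCount-even r) ⟩
  6 * ((2 + r) * (2 + r)) + (1 + r) * (2 + r) * (3 + r * 2)     ≡⟨ collect r ⟩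
  (1 + suc r) * (2 + suc r) * (3 + suc r * 2)                   ∎
  where
  open ≡-Reasoning
  collect : ∀ r → 6 * ((2 + r) * (2 + r)) + (1 + r) * (2 + r) * (3 + r * 2) ≡ (1 + suc r) * (2 + suc r) * (3 + suc r * 2)
  collect = solve-∀

quadrupleCount-odd : ∀ r → 3 * quadrupleCount (1 + r * 2) ≡ (1 + r) * (2 + r) * (3 + r)
quadrupleCount-odd zero    = refl
quadrupleCount-odd (suc r) = begin
  3 * (layeredSum suc (3 + r * 2) + quadrupleCount (1 + r * 2))     ≡⟨ *-distribˡ-+ 3 (layeredSum suc (3 + r * 2)) _ ⟩
  3 * layeredSum suc (3 + r * 2) + 3 * quadrupleCount (1 + r * 2)   ≡⟨ cong₂ _+_ (cong (3 *_) (tripleCount-odd (suc r))) (quadrupleCount-odd r) ⟩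
  3 * ((2 + r) * (3 + r)) + (1 + r) * (2 + r) * (3 + r)             ≡⟨ collect r ⟩
  (1 + suc r) * (2 + suc r) * (3 + suc r)                           ∎
  where
  open ≡-Reasoning
  collect : ∀ r → 3 * ((2 + r) * (3 + r)) + (1 + r) * (2 + r) * (3 + r) ≡ (1 + suc r) * (2 + suc r) * (3 + suc r)
  collect = solve-∀

/-≡ : ∀ p q d → p * suc d ≡ q → + p / 1 ≡ + q / suc d
/-≡ p q d eq = fromℚᵘ-cong {mkℚᵘ (+ p) 0} {mkℚᵘ (+ q) d} (*≡* (begin
  + p ℤ.* + suc d  ≡⟨ ℤ.pos-* p (suc d) ⟨
  + (p * suc d)    ≡⟨ cong +_ eq ⟩
  + q              ≡⟨ ℤ.*-identityʳ (+ q) ⟨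
  + q ℤ.* + 1      ∎))
  where open ≡-Reasoning

data Halved : ℕ → Set where
  even : ∀ r → Halved (r * 2)
  odd  : ∀ r → Halved (1 + r * 2)

halve : ∀ n → Halved n
halve 0             = even 0
halve 1             = odd 0
halve (suc (suc n)) with halve n
... | even r = even (suc r)
... | odd  r = odd (suc r)

a-even : ∀ n → Even n → a (+ n) ≡ + ((n + 2) C 3) / 4
a-even n ev with parity n | ev
... | 0ℙ | _ = refl

a-odd : ∀ n → Odd (1 + n) → a (+ (1 + n)) ≡ + (n * (2 + n) * (4 + n)) / 24
a-odd n od = trans (unfold od) (cong (_/ 24) (begin
  + n ℤ.* + (1 + n + 1) ℤ.* + (1 + n + 3)   ≡⟨ cong (ℤ._* + (1 + n + 3)) (ℤ.pos-* n (1 + n + 1)) ⟨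
  + (n * (1 + n + 1)) ℤ.* + (1 + n + 3)     ≡⟨ ℤ.pos-* (n * (1 + n + 1)) (1 + n + 3) ⟨
  + (n * (1 + n + 1) * (1 + n + 3))         ≡⟨ cong +_ (regroup n) ⟩
  + (n * (2 + n) * (4 + n))                 ∎))
  where
  open ≡-Reasoning
  regroup : ∀ n → n * (1 + n + 1) * (1 + n + 3) ≡ n * (2 + n) * (4 + n)
  regroup = solve-∀
  unfold : Odd (1 + n) → a (+ (1 + n)) ≡ (+ n ℤ.* + (1 + n + 1) ℤ.* + (1 + n + 3)) / 24
  unfold od with parity (1 + n) | od
  ... | 1ℙ | _ = refl

quadrupleCount≡a : ∀ n → + quadrupleCount n / 1 ≡ a (+ (2 + n))
quadrupleCount≡a n with halve n
... | even r = trans (/-≡ (quadrupleCount (r * 2)) ((2 + r * 2 + 2) C 3) 3 (*-cancelˡ-≡ _ _ 6 (begin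
  6 * (quadrupleCount (r * 2) * 4)                    ≡⟨ *-assoc 6 (quadrupleCount (r * 2)) 4 ⟨
  6 * quadrupleCount (r * 2) * 4                      ≡⟨ cong (_* 4) (quadrupleCount-even r) ⟩
  (1 + r) * (2 + r) * (3 + r * 2) * 4                 ≡⟨ collect r ⟩
  (r * 2 + 2) * (1 + (r * 2 + 2)) * (2 + (r * 2 + 2)) ≡⟨ 6*[n+2]C3 (r * 2 + 2) ⟨
  6 * ((2 + r * 2 + 2) C 3)                           ∎)))
  (sym (a-even (2 + r * 2) (double-even r)))
  where
  open ≡-Reasoning
  collect : ∀ r → (1 + r) * (2 + r) * (3 + r * 2) * 4 ≡ (r * 2 + 2) * (1 + (r * 2 + 2)) * (2 + (r * 2 + 2))
  collect = solve-∀
... | odd r = trans (/-≡ (quadrupleCount (1 + r * 2)) ((2 + r * 2) * (4 + r * 2) * (6 + r * 2)) 23 (begin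
  quadrupleCount (1 + r * 2) * 24          ≡⟨ regroup (quadrupleCount (1 + r * 2)) ⟩
  3 * quadrupleCount (1 + r * 2) * 8       ≡⟨ cong (_* 8) (quadrupleCount-odd r) ⟩
  (1 + r) * (2 + r) * (3 + r) * 8          ≡⟨ collect r ⟩
  (2 + r * 2) * (4 + r * 2) * (6 + r * 2)  ∎))
  (sym (a-odd (2 + r * 2) (suc-even (r * 2) (double-even r))))
  where
  open ≡-Reasoning
  regroup : ∀ q → q * 24 ≡ 3 * q * 8
  regroup = solve-∀
  collect : ∀ r → (1 + r) * (2 + r) * (3 + r) * 8 ≡ (2 + r * 2) * (4 + r * 2) * (6 + r * 2)
  collect = solve-∀

0<odd : ∀ {b} → Odd b → 0 < b
0<odd {suc b} _ = s≤s z≤n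

threshold-≤ : ∀ {k m} → m ≤ k → Threshold k m 0
threshold-≤ {k} m≤k = record
  { isEven      = refl
  ; large⇒above = λ odd-b _ → 0<odd odd-b
  ; above⇒large = λ _ 0<b → ≤-<-trans m≤k (m<m+n k 0<b)
  }

threshold-even : ∀ {k t} → Even t → Threshold k (k + t) t
threshold-even {k} even-t = record
  { isEven      = even-t
  ; large⇒above = λ _ → +-cancelˡ-< k _ _
  ; above⇒large = λ _ → +-monoʳ-< k
  }

threshold-odd : ∀ {k t} → Odd t → Threshold k (k + t) (suc t)
threshold-odd {k} {t} odd-t = record
  { isEven      = suc-odd t odd-t
  ; large⇒above = λ odd-b k+t<k+b → ≤∧≢⇒< (+-cancelˡ-< k _ _ k+t<k+b)
                    λ { refl → contradiction (trans (sym odd-b) (suc-odd t odd-t)) λ () }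
  ; above⇒large = λ _ 1+t<b → +-monoʳ-< k (<-trans (n<1+n t) 1+t<b)
  }

Count : ℕ → ℕ → ℚ → Set
Count k m = NumberOfPermutations[ m ∣ OddBiGrassmannianAvoiding k ]≡_

count-zero : ∀ {k m e} → Threshold k m e → m < 2 + (e + e) → Count k m 0ℚ
count-zero threshold m<2+2e = 0 , cardinality-zero threshold m<2+2e , refl

count-a : ∀ {k m e} → Threshold k m e → ∀ d → m ≡ e + e + d → Count k m (a (+ d))
count-a {e = e} threshold 0 refl = count-zero threshold
  (s≤s (m≤n⇒m≤1+n (≤-reflexive (+-identityʳ (e + e)))))
count-a {e = e} threshold 1 refl = count-zero threshold (s≤s (≤-reflexive (+-comm (e + e) 1)))
count-a {e = e} threshold (suc (suc n)) m≡ =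
  quadrupleCount n , cardinality threshold (trans m≡ (regroup e n)) , quadrupleCount≡a n
  where
  regroup : ∀ e n → e + e + (2 + n) ≡ 2 + (e + e) + n
  regroup = solve-∀

[q+d]-q≡d : ∀ {p} q d → p ≡ q + d → + p - + q ≡ + d
[q+d]-q≡d q d refl = begin
  + (q + d) - + q   ≡⟨ ℤ.m-n≡m⊖n (q + d) q ⟩
  (q + d) ℤ.⊖ q     ≡⟨ ℤ.⊖-≥ (m≤m+n q d) ⟩
  + (q + d ∸ q)     ≡⟨ cong +_ (m+n∸m≡n q d) ⟩
  + d               ∎
  where open ≡-Reasoning

k+t<2k⇒t<k : ∀ k t → k + t < 2 * k → t < k
k+t<2k⇒t<k k t lt = subst (t <_) (+-identityʳ k) (+-cancelˡ-< k t (k + 0) lt)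

count-even : ∀ k t → Even t → k + t < 2 * k → Count k (k + t) (a (+ (2 * k) - + (k + t)))
count-even k t even-t m<2k with m≤n⇒∃[o]m+o≡n (<⇒≤ (k+t<2k⇒t<k k t m<2k))
... | d , refl = subst (Count k (k + t)) (cong a (sym ([q+d]-q≡d (k + t) d (double t d))))
  (count-a (threshold-even even-t) d (xy∙z≈xz∙y t d t))
  where
  double : ∀ t d → 2 * (t + d) ≡ t + d + t + d
  double = solve-∀

count-odd : ∀ k t → Odd t → k + t < 2 * k → Count k (k + t) (a (+ (2 * k) - + (k + t) - + 2))
count-odd k t odd-t m<2k with m≤n⇒∃[o]m+o≡n (k+t<2k⇒t<k k t m<2k)
... | zero , refl = subst (Count k (k + t)) (cong (λ z → a (z - + 2)) (sym ([q+d]-q≡d (k + t) 1 (double t))))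
  (count-zero (threshold-odd odd-t) (bound t))
  where
  double : ∀ t → 2 * (suc t + 0) ≡ suc t + 0 + t + 1
  double = solve-∀
  bound : ∀ t → suc t + 0 + t < 2 + (suc t + suc t)
  bound t rewrite +-identityʳ t = s≤s (s≤s (≤-trans (+-monoʳ-≤ t (n≤1+n t)) (n≤1+n _)))
... | suc d , refl = subst (Count k (k + t))
  (cong (λ z → a (z - + 2)) (sym ([q+d]-q≡d (k + t) (2 + d) (double t d))))
  (count-a (threshold-odd odd-t) d (regroup t d))
  where
  double : ∀ t d → 2 * (suc t + suc d) ≡ suc t + suc d + t + (2 + d)
  double = solve-∀
  regroup : ∀ t d → suc t + suc d + t ≡ suc t + suc t + d
  regroup = solve-∀

count-none : ∀ k t → k ≤ t → Count k (k + t) 0ℚ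
count-none k t k≤t with parity t in parity-t
... | 0ℙ = count-zero (threshold-even parity-t) (s≤s (m≤n⇒m≤1+n (+-monoˡ-≤ t k≤t)))
... | 1ℙ = count-zero (threshold-odd parity-t)
  (s≤s (m≤n⇒m≤1+n (+-mono-≤ (m≤n⇒m≤1+n k≤t) (n≤1+n t))))

theorem5p4 : ∀ (k m : ℕ) → 1 ≤ k → 1 ≤ m →
    (m ≤ k →
    NumberOfPermutations[ m ∣ OddBiGrassmannianAvoiding k ]≡ a (+ m))
    × (k < m → m < 2 * k → Even (m ∸ k) →
    NumberOfPermutations[ m ∣ OddBiGrassmannianAvoiding k ]≡ a (+ (2 * k) - + m))
    × (k < m → m < 2 * k → Odd (m ∸ k) →
    NumberOfPermutations[ m ∣ OddBiGrassmannianAvoiding k ]≡ a (+ (2 * k) - + m - + 2))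
    × (2 * k ≤ m →
    NumberOfPermutations[ m ∣ OddBiGrassmannianAvoiding k ]≡ 0ℚ)
theorem5p4 k m _ _ = (λ m≤k → count-a (threshold-≤ m≤k) m refl) , even-case , odd-case , none-case
  where
  even-case : k < m → m < 2 * k → Even (m ∸ k) → Count k m (a (+ (2 * k) - + m))
  even-case k<m m<2k even-t with m≤n⇒∃[o]m+o≡n (<⇒≤ k<m)
  ... | t , refl = count-even k t (subst Even (m+n∸m≡n k t) even-t) m<2k
  odd-case : k < m → m < 2 * k → Odd (m ∸ k) → Count k m (a (+ (2 * k) - + m - + 2))
  odd-case k<m m<2k odd-t with m≤n⇒∃[o]m+o≡n (<⇒≤ k<m)
  ... | t , refl = count-odd k t (subst Odd (m+n∸m≡n k t) odd-t) m<2k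
  none-case : 2 * k ≤ m → Count k m 0ℚ
  none-case 2k≤m with m≤n⇒∃[o]m+o≡n (≤-trans (m≤m+n k (k + 0)) 2k≤m)
  ... | t , refl = count-none k t (subst (_≤ t) (+-identityʳ k) (+-cancelˡ-≤ k (k + 0) t 2k≤m))
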